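{- Let $r\geq 1$ be an integer and let $t=1260r+169$. Then for every integer $n\geq 540t^2+\frac{175811}{2}t+\frac{7989}{2}$, $$f(n)\geq n+36t,$$ where $f(n)$ denotes the maximum number of edges in a graph on $n$ vertices in which no two distinct cycles have the same length.
   Context: Graphs are finite and undirected, and loops and multiple edges are allowed. A cycle is a connected subgraph in which every vertex has degree 2 (a loop contributing 2 to the degree of its vertex); its length is its number of edges. Thus a loop is a cycle of length 1, and a pair of parallel edges forms a cycle of length 2. Two cycles are distinct if they are different as subgraphs (equivalently, have different edge sets). For a positive integer $n$, $f(n)$ is the maximum number of edges in a graph on $n$ vertices in which any two distinct cycles have different lengths. -}

module Defs where

open import Data.Bool.Properties using () renaming (_≟_ to _≟ᴮ_)
open import Data.Fin.Base using (Fin; zero; suc; combine; _↑ˡ_; _↑ʳ_; splitAt)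
open import Data.Fin.Properties
  using (_≟_; pigeonhole; combine-injective; <⇒≢; ↑ˡ-injective; ↑ʳ-injective; splitAt-↑ˡ; splitAt-↑ʳ)
import Data.Fin.Properties as Fin
open import Data.Fin.Subset using (Subset; _∈_; _∉_; _∩_; _∪_; ∣_∣; Nonempty; ⁅_⁆)
open import Data.Fin.Subset.Properties
open import Data.List.Base as List using (List; []; _∷_)
import Data.List.Membership.Propositional as List
import Data.List.Membership.Propositional.Properties as List
open import Data.List.Relation.Unary.Any using (here; there)
open import Data.Nat.Base using (ℕ; zero; suc; _+_; _*_; _≤_; _<_)
import Data.Nat.Properties as ℕ
open import Data.Product.Base using (Σ; ∃; _×_; _,_; proj₁; proj₂)
open import Data.Sum.Base using (_⊎_; inj₁; inj₂; [_,_]′)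
open import Data.Vec.Base as Vec using (Vec; []; _∷_; tabulate; lookup)
import Data.Vec.Properties as Vec
open import Function.Base using (_∘_)
open import Relation.Binary.Construct.Closure.ReflexiveTransitive as Star
  using (Star; ε; _◅_; _◅◅_)
open import Relation.Binary.PropositionalEquality
open import Relation.Nullary
open import Relation.Nullary.Decidable using (dec-true; dec-false)

------------------------------------------------------------------------
-- Graphs with loops and multiple edges, and their cycles

-- The two ends of an edge are listed in an arbitrary order; none of the notions
-- below depends on that order.
record Graph (n m : ℕ) : Set where
  field
    ends : Fin m → Fin n × Fin n

  start end : Fin m → Fin n
  start = proj₁ ∘ ends
  end   = proj₂ ∘ ends

open Graph using (ends; start; end)

module _ {n m : ℕ} where

  record Subgraph (G : Graph n m) : Set where
    field
      vertices : Subset n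
      edges    : Subset m
      closed   : ∀ e → e ∈ edges → start G e ∈ vertices × end G e ∈ vertices

    size : ℕ
    size = ∣ edges ∣

  open Subgraph using (vertices; edges; size)

  SameSubgraph : {G : Graph n m} (C D : Subgraph G) → Set
  SameSubgraph C D = vertices C ≡ vertices D × edges C ≡ edges D

  startingAt endingAt : Graph n m → Fin n → Subset m
  startingAt G v = tabulate λ e → does (start G e ≟ v)
  endingAt   G v = tabulate λ e → does (end G e ≟ v)

  -- A loop at v both starts and ends at v, so it contributes 2.
  degree : {G : Graph n m} → Subgraph G → Fin n → ℕ
  degree {G} C v = ∣ edges C ∩ startingAt G v ∣ + ∣ edges C ∩ endingAt G v ∣

  Adjacent : {G : Graph n m} → Subgraph G → Fin n → Fin n → Set
  Adjacent {G} C u v =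
    ∃ λ e → e ∈ edges C × (ends G e ≡ (u , v) ⊎ ends G e ≡ (v , u))

  Walk : {G : Graph n m} → Subgraph G → Fin n → Fin n → Set
  Walk C = Star (Adjacent C)

  -- The empty subgraph does not count as connected.
  record IsConnected {G : Graph n m} (C : Subgraph G) : Set where
    field
      nonempty : Nonempty (vertices C)
      walk     : ∀ u v → u ∈ vertices C → v ∈ vertices C → Walk C u v

  record IsCycle {G : Graph n m} (C : Subgraph G) : Set where
    field
      connected : IsConnected C
      regular   : ∀ v → v ∈ vertices C → degree C v ≡ 2

  DistinctCycleLengths : Graph n m → Set
  DistinctCycleLengths G =
    ∀ (C D : Subgraph G) → IsCycle C → IsCycle D →
    ¬ SameSubgraph C D → size C ≢ size D

-- Some graph with n vertices and m edges has no two distinct cycles of the same length.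
Admissible : ℕ → ℕ → Set
Admissible n m = Σ (Graph n m) DistinctCycleLengths

IsMaximum : (ℕ → Set) → ℕ → Set
IsMaximum P m = P m × (∀ k → P k → k ≤ m)

------------------------------------------------------------------------
-- Existence of the maximum.  Admissibility is decidable, 0 edges are admissible,
-- and the number of edges is bounded: many edges force two disjoint pairs of
-- parallel edges (or of loops at the same vertex).

maximum : ∀ {P : ℕ → Set} → (∀ k → Dec (P k)) → P 0 →
          ∀ b → (∀ k → P k → k ≤ b) → ∃ (IsMaximum P)
maximum P? p₀ zero    bound = 0 , p₀ , bound
maximum P? p₀ (suc b) bound with P? (suc b)
... | yes p = suc b , p , bound
... | no ¬p = maximum P? p₀ b λ k pk →
  ℕ.≤-pred (ℕ.≤∧≢⇒< (bound k pk) λ { refl → ¬p pk })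

-- Decidability of connection by walks, by recursion on the list of edges

Step : ∀ {n} → List (Fin n × Fin n) → Fin n → Fin n → Set
Step es u v = (u , v) List.∈ es ⊎ (v , u) List.∈ es

step-there : ∀ {n} {x} {es : List (Fin n × Fin n)} {u v} → Step es u v → Step (x ∷ es) u v
step-there (inj₁ p) = inj₁ (there p)
step-there (inj₂ p) = inj₂ (there p)

Through : ∀ {n} (a b : Fin n) (es : List (Fin n × Fin n)) → Fin n → Fin n → Set
Through a b es u v =
  Star (Step es) u v ⊎
  (Star (Step es) u a × Star (Step es) b v) ⊎
  (Star (Step es) u b × Star (Step es) a v)

split-walk : ∀ {n} {a b : Fin n} {es u v} →
             Star (Step ((a , b) ∷ es)) u v → Through a b es u v
split-walk ε = inj₁ ε
split-walk (inj₁ (there p) ◅ w) with split-walk w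
... | inj₁ w′              = inj₁ (inj₁ p ◅ w′)
... | inj₂ (inj₁ (x , y))  = inj₂ (inj₁ (inj₁ p ◅ x , y))
... | inj₂ (inj₂ (x , y))  = inj₂ (inj₂ (inj₁ p ◅ x , y))
split-walk (inj₂ (there p) ◅ w) with split-walk w
... | inj₁ w′              = inj₁ (inj₂ p ◅ w′)
... | inj₂ (inj₁ (x , y))  = inj₂ (inj₁ (inj₂ p ◅ x , y))
... | inj₂ (inj₂ (x , y))  = inj₂ (inj₂ (inj₂ p ◅ x , y))
split-walk (inj₁ (here refl) ◅ w) with split-walk w
... | inj₁ w′              = inj₂ (inj₁ (ε , w′))
... | inj₂ (inj₁ (x , y))  = inj₂ (inj₁ (ε , y))
... | inj₂ (inj₂ (x , y))  = inj₁ y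
split-walk (inj₂ (here refl) ◅ w) with split-walk w
... | inj₁ w′              = inj₂ (inj₂ (ε , w′))
... | inj₂ (inj₁ (x , y))  = inj₁ y
... | inj₂ (inj₂ (x , y))  = inj₂ (inj₂ (ε , y))

join-walk : ∀ {n} {a b : Fin n} {es u v} →
            Through a b es u v → Star (Step ((a , b) ∷ es)) u v
join-walk (inj₁ w)              = Star.map step-there w
join-walk (inj₂ (inj₁ (x , y))) =
  Star.map step-there x ◅◅ (inj₁ (here refl) ◅ Star.map step-there y)
join-walk (inj₂ (inj₂ (x , y))) =
  Star.map step-there x ◅◅ (inj₂ (here refl) ◅ Star.map step-there y)

step-walk? : ∀ {n} (es : List (Fin n × Fin n)) u v → Dec (Star (Step es) u v)
step-walk? [] u v = map′ (λ { refl → ε }) from (u ≟ v)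
  where
  from : ∀ {u v} → Star (Step []) u v → u ≡ v
  from ε             = refl
  from (inj₁ () ◅ _)
  from (inj₂ () ◅ _)
step-walk? ((a , b) ∷ es) u v = map′ join-walk split-walk
  (step-walk? es u v ⊎-dec
   ((step-walk? es u a ×-dec step-walk? es b v) ⊎-dec
    (step-walk? es u b ×-dec step-walk? es a v)))

module _ {n m : ℕ} {G : Graph n m} (C : Subgraph G) where
  open Subgraph C

  edgeList : List (Fin n × Fin n)
  edgeList = List.map (ends G) (List.filter (_∈? edges) (List.allFin m))

  listed : ∀ {e x} → e ∈ edges → ends G e ≡ x → x List.∈ edgeList
  listed {e} p refl = List.∈-map⁺ (ends G) (List.∈-filter⁺ (_∈? edges) (List.∈-allFin e) p)

  unlisted : ∀ {x} → x List.∈ edgeList → ∃ λ e → e ∈ edges × ends G e ≡ x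
  unlisted p with List.∈-map⁻ (ends G) p
  ... | e , q , eq = e , proj₂ (List.∈-filter⁻ (_∈? edges) {xs = List.allFin m} q) , sym eq

  walk? : ∀ u v → Dec (Walk C u v)
  walk? u v = map′ (Star.map to) (Star.map from) (step-walk? edgeList u v)
    where
    to : ∀ {u v} → Step edgeList u v → Adjacent C u v
    to (inj₁ p) = let e , q , eq = unlisted p in e , q , inj₁ eq
    to (inj₂ p) = let e , q , eq = unlisted p in e , q , inj₂ eq
    from : ∀ {u v} → Adjacent C u v → Step edgeList u v
    from (e , p , inj₁ eq) = inj₁ (listed p eq)
    from (e , p , inj₂ eq) = inj₂ (listed p eq)

  isConnected? : Dec (IsConnected C)
  isConnected? = map′
    (λ (ne , w) → record { nonempty = ne ; walk = w })
    (λ c → IsConnected.nonempty c , IsConnected.walk c)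
    (nonempty? vertices ×-dec
     Fin.all? λ u → Fin.all? λ v → u ∈? vertices →-dec (v ∈? vertices →-dec walk? u v))

  isCycle? : Dec (IsCycle C)
  isCycle? = map′
    (λ (c , r) → record { connected = c ; regular = r })
    (λ c → IsCycle.connected c , IsCycle.regular c)
    (isConnected? ×-dec
     Fin.all? λ v → v ∈? vertices →-dec degree C v ℕ.≟ 2)

-- Being a cycle depends only on the two sets and on the values of ends.

transfer : ∀ {n m} {G H : Graph n m} → (∀ e → ends G e ≡ ends H e) →
           (C : Subgraph G) (D : Subgraph H) →
           Subgraph.vertices C ≡ Subgraph.vertices D → Subgraph.edges C ≡ Subgraph.edges D →
           IsCycle C → IsCycle D
transfer {G = G} {H} eq C D refl refl c = record
  { connected = record
    { nonempty = IsConnected.nonempty (IsCycle.connected c)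
    ; walk     = λ u v p q → Star.map adj (IsConnected.walk (IsCycle.connected c) u v p q)
    }
  ; regular = λ v p → trans (sym (deg v)) (IsCycle.regular c v p)
  }
  where
  adj : ∀ {u v} → Adjacent C u v → Adjacent D u v
  adj (e , p , inj₁ q) = e , p , inj₁ (trans (sym (eq e)) q)
  adj (e , p , inj₂ q) = e , p , inj₂ (trans (sym (eq e)) q)
  deg : ∀ v → degree C v ≡ degree D v
  deg v = cong₂ (λ A B → ∣ Subgraph.edges D ∩ A ∣ + ∣ Subgraph.edges D ∩ B ∣)
    (Vec.tabulate-cong λ e → cong (λ x → does (proj₁ x ≟ v)) (eq e))
    (Vec.tabulate-cong λ e → cong (λ x → does (proj₂ x ≟ v)) (eq e))

distinctCycleLengths-cong : ∀ {n m} {G H : Graph n m} → (∀ e → ends G e ≡ ends H e) →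
                            DistinctCycleLengths G → DistinctCycleLengths H
distinctCycleLengths-cong {G = G} {H} eq d C D c c′ =
  d (pull C) (pull D)
    (transfer (sym ∘ eq) C (pull C) refl refl c) (transfer (sym ∘ eq) D (pull D) refl refl c′)
  where
  pull : Subgraph H → Subgraph G
  pull C = record
    { vertices = Subgraph.vertices C
    ; edges    = Subgraph.edges C
    ; closed   = λ e p → subst (λ x → proj₁ x ∈ Subgraph.vertices C × proj₂ x ∈ Subgraph.vertices C)
                               (sym (eq e)) (Subgraph.closed C e p)
    }

-- Decidability of admissibility

module _ {n m : ℕ} (G : Graph n m) where

  Clash : (V : Subset n) (E : Subset m) (W : Subset n) (F : Subset m) → Set
  Clash V E W F = ∃ λ c → ∃ λ d →
    let C = record { vertices = V ; edges = E ; closed = c }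
        D = record { vertices = W ; edges = F ; closed = d }
    in IsCycle {G = G} C × IsCycle {G = G} D × (¬ SameSubgraph C D × ∣ E ∣ ≡ ∣ F ∣)

  closed? : (V : Subset n) (E : Subset m) →
            Dec (∀ e → e ∈ E → start G e ∈ V × end G e ∈ V)
  closed? V E = Fin.all? λ e → e ∈? E →-dec (start G e ∈? V ×-dec end G e ∈? V)

  clash? : ∀ V E W F → Dec (Clash V E W F)
  clash? V E W F with closed? V E | closed? W F
  ... | no ¬c | _     = no λ (c , _) → ¬c c
  ... | _     | no ¬d = no λ (_ , d , _) → ¬d d
  ... | yes c | yes d = map′
    (λ p → c , d , p)
    (λ (c′ , d′ , x , y , z) →
      transfer (λ _ → refl) _ _ refl refl x , transfer (λ _ → refl) _ _ refl refl y , z)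
    (isCycle? _ ×-dec isCycle? _ ×-dec
     (¬? (Vec.≡-dec _≟ᴮ_ V W ×-dec Vec.≡-dec _≟ᴮ_ E F) ×-dec ∣ E ∣ ℕ.≟ ∣ F ∣))

  distinctCycleLengths? : Dec (DistinctCycleLengths G)
  distinctCycleLengths? = map′ to from
    (¬? (anySubset? λ V → anySubset? λ E → anySubset? λ W → anySubset? λ F → clash? V E W F))
    where
    SomeClash = ∃ λ V → ∃ λ E → ∃ λ W → ∃ λ F → Clash V E W F
    to : ¬ SomeClash → DistinctCycleLengths G
    to no-clash C D c d diff same =
      no-clash (_ , _ , _ , _ , Subgraph.closed C , Subgraph.closed D , c , d , diff , same)
    from : DistinctCycleLengths G → ¬ SomeClash
    from dist (_ , _ , _ , _ , _ , _ , c , d , diff , same) = dist _ _ c d diff same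

anyVec? : ∀ {A : Set} → (∀ {P : A → Set} → (∀ x → Dec (P x)) → Dec (∃ P)) →
          ∀ m {P : Vec A m → Set} → (∀ xs → Dec (P xs)) → Dec (∃ P)
anyVec? any zero    P? = map′ (λ p → [] , p) (λ { ([] , p) → p }) (P? [])
anyVec? any (suc m) P? = map′
  (λ (x , xs , p) → x ∷ xs , p) (λ { (x ∷ xs , p) → x , xs , p })
  (any λ x → anyVec? any m λ xs → P? (x ∷ xs))

anyPair? : ∀ {n} {P : Fin n × Fin n → Set} → (∀ x → Dec (P x)) → Dec (∃ P)
anyPair? P? = map′
  (λ (x , y , p) → (x , y) , p) (λ ((x , y) , p) → x , y , p)
  (Fin.any? λ x → Fin.any? λ y → P? (x , y))

admissible? : ∀ n m → Dec (Admissible n m)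
admissible? n m = map′
  (λ (xs , d) → fromVec xs , d)
  (λ (G , d) → tabulate (ends G) ,
    distinctCycleLengths-cong (λ e → sym (Vec.lookup∘tabulate (ends G) e)) d)
  (anyVec? anyPair? m λ xs → distinctCycleLengths? (fromVec xs))
  where
  fromVec : Vec (Fin n × Fin n) m → Graph n m
  fromVec xs = record { ends = lookup xs }

admissible-0 : ∀ n → Admissible n 0
admissible-0 n = record { ends = λ () } , no-cycle
  where
  no-cycle : DistinctCycleLengths _
  no-cycle C D c d _ _ with Subgraph.edges C | IsConnected.nonempty (IsCycle.connected c)
                          | IsCycle.regular c
  ... | [] | v , p | r with () ← r v p

-- The bound

∣∩∣-full : ∀ {m} {E S : Subset m} → (∀ {e} → e ∈ E → e ∈ S) → ∣ E ∩ S ∣ ≡ ∣ E ∣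
∣∩∣-full {E = E} {S} h =
  ℕ.≤-antisym (∣p∩q∣≤∣p∣ E S) (p⊆q⇒∣p∣≤∣q∣ λ p → x∈p∩q⁺ (p , h p))

∣∩∣-empty : ∀ {m} {E S : Subset m} → (∀ {e} → e ∈ E → e ∉ S) → ∣ E ∩ S ∣ ≡ 0
∣∩∣-empty {m} {E} {S} h = trans
  (cong ∣_∣ (Empty-unique λ (e , p) → let q , r = x∈p∩q⁻ E S p in h q r)) (∣⊥∣≡0 m)

∣pair∣ : ∀ {m} (i j : Fin m) → i ≢ j → ∣ ⁅ i ⁆ ∪ ⁅ j ⁆ ∣ ≡ 2
∣pair∣ zero    zero    i≢j = contradiction refl i≢j
∣pair∣ zero    (suc j) i≢j =
  cong suc (trans (cong ∣_∣ (∪-identityˡ ⁅ j ⁆)) (∣⁅x⁆∣≡1 j))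
∣pair∣ (suc i) zero    i≢j =
  cong suc (trans (cong ∣_∣ (∪-identityʳ ⁅ i ⁆)) (∣⁅x⁆∣≡1 i))
∣pair∣ (suc i) (suc j) i≢j = ∣pair∣ i j (i≢j ∘ cong suc)

∈-pair : ∀ {m} {i j e : Fin m} → e ∈ ⁅ i ⁆ ∪ ⁅ j ⁆ → e ≡ i ⊎ e ≡ j
∈-pair {i = i} {j} p with x∈p∪q⁻ ⁅ i ⁆ ⁅ j ⁆ p
... | inj₁ q = inj₁ (x∈⁅y⁆⇒x≡y i q)
... | inj₂ q = inj₂ (x∈⁅y⁆⇒x≡y j q)

pairˡ : ∀ {m} (i j : Fin m) → i ∈ ⁅ i ⁆ ∪ ⁅ j ⁆
pairˡ i j = x∈p∪q⁺ (inj₁ (x∈⁅x⁆ i))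

pairʳ : ∀ {m} (i j : Fin m) → j ∈ ⁅ i ⁆ ∪ ⁅ j ⁆
pairʳ i j = x∈p∪q⁺ (inj₂ (x∈⁅x⁆ j))

module _ {n m : ℕ} {G : Graph n m} where

  ∈-tabulate⁺ : ∀ {h : Fin m → Fin n} {v e} → h e ≡ v → e ∈ tabulate λ e → does (h e ≟ v)
  ∈-tabulate⁺ {h} {v} {e} eq = Vec.lookup⇒[]= e _
    (trans (Vec.lookup∘tabulate _ e) (dec-true (h e ≟ v) eq))

  ∉-tabulate⁺ : ∀ {h : Fin m → Fin n} {v e} → h e ≢ v → e ∉ tabulate λ e → does (h e ≟ v)
  ∉-tabulate⁺ {h} {v} {e} ne p with () ←
    trans (sym (Vec.[]=⇒lookup p))
          (trans (Vec.lookup∘tabulate _ e) (dec-false (h e ≟ v) ne))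

  loop : ∀ e → start G e ≡ end G e → Subgraph G
  loop e eq = record
    { vertices = ⁅ start G e ⁆
    ; edges    = ⁅ e ⁆
    ; closed   = λ e′ p → subst (λ e′ → start G e′ ∈ _ × end G e′ ∈ _) (sym (x∈⁅y⁆⇒x≡y e p))
                   (x∈⁅x⁆ _ , subst (_∈ ⁅ start G e ⁆) eq (x∈⁅x⁆ _))
    }

  loop-isCycle : ∀ e eq → IsCycle (loop e eq)
  loop-isCycle e eq = record
    { connected = record
      { nonempty = _ , x∈⁅x⁆ _
      ; walk     = λ u v p q →
          subst (Walk (loop e eq) u)
            (trans (x∈⁅y⁆⇒x≡y _ p) (sym (x∈⁅y⁆⇒x≡y _ q))) ε
      }
    ; regular = λ v p → let v≡s = sym (x∈⁅y⁆⇒x≡y _ p) in cong₂ _+_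
        (trans (∣∩∣-full λ q → ∈-tabulate⁺ {h = start G}
          (trans (cong (start G) (x∈⁅y⁆⇒x≡y e q)) v≡s)) (∣⁅x⁆∣≡1 e))
        (trans (∣∩∣-full λ q → ∈-tabulate⁺ {h = end G}
          (trans (cong (end G) (x∈⁅y⁆⇒x≡y e q)) (trans (sym eq) v≡s))) (∣⁅x⁆∣≡1 e))
    }

  module _ {i j : Fin m} (i≢j : i ≢ j) (par : ends G i ≡ ends G j)
           (u≢v : start G i ≢ end G i) where

    private
      u = start G i
      v = end G i

      par-start : ∀ {e} → e ∈ ⁅ i ⁆ ∪ ⁅ j ⁆ → start G e ≡ u
      par-start p with ∈-pair p
      ... | inj₁ refl = refl
      ... | inj₂ refl = cong proj₁ (sym par)

      par-end : ∀ {e} → e ∈ ⁅ i ⁆ ∪ ⁅ j ⁆ → end G e ≡ v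
      par-end p with ∈-pair p
      ... | inj₁ refl = refl
      ... | inj₂ refl = cong proj₂ (sym par)

    digon : Subgraph G
    digon = record
      { vertices = ⁅ u ⁆ ∪ ⁅ v ⁆
      ; edges    = ⁅ i ⁆ ∪ ⁅ j ⁆
      ; closed   = λ e p → subst (_∈ ⁅ u ⁆ ∪ ⁅ v ⁆) (sym (par-start p)) (pairˡ u v)
                         , subst (_∈ ⁅ u ⁆ ∪ ⁅ v ⁆) (sym (par-end p)) (pairʳ u v)
      }

    digon-isCycle : IsCycle digon
    digon-isCycle = record
      { connected = record { nonempty = u , pairˡ u v ; walk = walk }
      ; regular   = regular
      }
      where
      walk : ∀ x y → x ∈ ⁅ u ⁆ ∪ ⁅ v ⁆ → y ∈ ⁅ u ⁆ ∪ ⁅ v ⁆ → Walk digon x y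
      walk x y p q with ∈-pair p | ∈-pair q
      ... | inj₁ refl | inj₁ refl = ε
      ... | inj₁ refl | inj₂ refl = (i , pairˡ i j , inj₁ refl) ◅ ε
      ... | inj₂ refl | inj₁ refl = (i , pairˡ i j , inj₂ refl) ◅ ε
      ... | inj₂ refl | inj₂ refl = ε
      regular : ∀ x → x ∈ ⁅ u ⁆ ∪ ⁅ v ⁆ → degree digon x ≡ 2
      regular x p with ∈-pair p
      ... | inj₁ refl = cong₂ _+_
        (trans (∣∩∣-full λ q → ∈-tabulate⁺ {h = start G} (par-start q)) (∣pair∣ i j i≢j))
        (∣∩∣-empty λ q → ∉-tabulate⁺ {h = end G} λ eq → u≢v (trans (sym eq) (par-end q)))
      ... | inj₂ refl = cong₂ _+_
        (∣∩∣-empty λ q → ∉-tabulate⁺ {h = start G} λ eq → u≢v (trans (sym (par-start q)) eq))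
        (trans (∣∩∣-full λ q → ∈-tabulate⁺ {h = end G} (par-end q)) (∣pair∣ i j i≢j))

  no-parallel-loops : DistinctCycleLengths G → ∀ {i j} → i ≢ j → ends G i ≡ ends G j →
                      start G i ≢ end G i
  no-parallel-loops d {i} {j} i≢j par eq =
    d (loop i eq) (loop j eq′) (loop-isCycle i eq) (loop-isCycle j eq′)
      (λ (_ , same) → i≢j (x∈⁅y⁆⇒x≡y j (subst (i ∈_) same (x∈⁅x⁆ i))))
      (trans (∣⁅x⁆∣≡1 i) (sym (∣⁅x⁆∣≡1 j)))
    where
    eq′ : start G j ≡ end G j
    eq′ = subst (λ x → proj₁ x ≡ proj₂ x) par eq

  no-two-parallel-pairs : DistinctCycleLengths G →
    ∀ {i j k l} → i ≢ j → k ≢ l → ends G i ≡ ends G j → ends G k ≡ ends G l →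
    ¬ (i ≢ k × i ≢ l)
  no-two-parallel-pairs d {i} {j} {k} {l} i≢j k≢l p q (i≢k , i≢l) =
    d (digon i≢j p u≢v) (digon k≢l q x≢y) (digon-isCycle i≢j p u≢v) (digon-isCycle k≢l q x≢y)
      (λ (_ , same) → [ i≢k , i≢l ]′ (∈-pair (subst (i ∈_) same (pairˡ i j))))
      (trans (∣pair∣ i j i≢j) (sym (∣pair∣ k l k≢l)))
    where
    u≢v = no-parallel-loops d i≢j p
    x≢y = no-parallel-loops d k≢l q

parallel-pair : ∀ {n k} (g : Fin k → Fin n × Fin n) → n * n < k → ∃ λ i → ∃ λ j → i ≢ j × g i ≡ g j
parallel-pair g lt with pigeonhole lt (λ i → combine (proj₁ (g i)) (proj₂ (g i)))
... | i , j , i<j , eq = i , j , <⇒≢ i<j ,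
  (let p , q = combine-injective _ _ _ _ eq in cong₂ _,_ p q)

admissible-bound : ∀ n m → Admissible n m → m ≤ suc (n * n) + suc (n * n)
admissible-bound n m (G , d) with m ℕ.≤? suc (n * n) + suc (n * n)
... | yes p = p
... | no ¬p with ℕ.m≤n⇒∃[o]m+o≡n (ℕ.<⇒≤ (ℕ.≰⇒> ¬p))
... | o , refl = contradiction (separate , separate) (no-two-parallel-pairs d
      (i≢j ∘ in₁-injective) (k≢l ∘ in₂-injective) p q)
  where
  b : ℕ
  b = suc (n * n)
  in₁ in₂ : Fin b → Fin (b + b + o)
  in₁ x = (x ↑ˡ b) ↑ˡ o
  in₂ x = (b ↑ʳ x) ↑ˡ o
  in₁-injective : ∀ {x y} → in₁ x ≡ in₁ y → x ≡ y
  in₁-injective e = ↑ˡ-injective b _ _ (↑ˡ-injective o _ _ e)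
  in₂-injective : ∀ {x y} → in₂ x ≡ in₂ y → x ≡ y
  in₂-injective e = ↑ʳ-injective b _ _ (↑ˡ-injective o _ _ e)
  separate : ∀ {x y} → in₁ x ≢ in₂ y
  separate {x} {y} e with () ← trans (sym (splitAt-↑ˡ b x b))
    (trans (cong (splitAt b) (↑ˡ-injective o (x ↑ˡ b) (b ↑ʳ y) e)) (splitAt-↑ʳ b b y))
  pair₁ = parallel-pair (ends G ∘ in₁) ℕ.≤-refl
  pair₂ = parallel-pair (ends G ∘ in₂) ℕ.≤-refl
  i≢j = proj₁ (proj₂ (proj₂ pair₁))
  k≢l = proj₁ (proj₂ (proj₂ pair₂))
  p   = proj₂ (proj₂ (proj₂ pair₁))
  q   = proj₂ (proj₂ (proj₂ pair₂))

abstract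
  admissible-maximum : ∀ n → ∃ (IsMaximum (Admissible n))
  admissible-maximum n =
    maximum (admissible? n) (admissible-0 n) (suc (n * n) + suc (n * n)) (admissible-bound n)

------------------------------------------------------------------------

-- The maximum number of edges in a graph on n vertices in which no two distinct
-- cycles have the same length.
f : ℕ → ℕ
f n = proj₁ (admissible-maximum n)

f-isMaximum : ∀ n → IsMaximum (Admissible n) (f n)
f-isMaximum n = proj₂ (admissible-maximum n)

{-# OPTIONS --safe #-}
-- A fan consists of a root, a path, and edges ("spokes") from the root to the vertices of
-- the path, all subdivided.  With seven spokes 0, …, 6 it has 6 independent cycles and only
-- 21 cycles, one for each pair of spokes, and the cycle through the spokes j < k has a length
-- of the form a_j + b_k.  The a_j and b_k (found by a computer search) are chosen so that the
-- fans i = 0, …, 5u-1 together tile an interval of lengths almost without gaps, while the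
-- faces of the fans, whose lengths add up to twice the number of edges, are mostly near its
-- lower end.
-- Gluing these fans and one cycle of each length 1, …, 42u+37 at a common root gives
-- 72u+37 = 36t+1 independent cycles, where t = 2u+1, on about 2154.5u² < 540t² vertices.
module Submission where

open import Defs
open import Data.Bool.Base using (Bool; true; false; if_then_else_)
open import Data.Bool.Properties using () renaming (_≟_ to _≟ᴮ_)
import Data.Empty as Empty
open import Data.Fin using (#_)
open import Data.Fin.Base using (Fin; zero; suc; _↑ˡ_; _↑ʳ_; splitAt)
open import Data.Fin.Properties
  using (_≟_; all?; suc-injective; ↑ˡ-injective; ↑ʳ-injective; splitAt-↑ˡ; splitAt-↑ʳ)
open import Data.Fin.Subset using (Subset; _∈_; _⊆_; _∩_; ∣_∣; ⊥)
open import Data.Fin.Subset.Properties using (_∈?_; ⊆-antisym)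
open import Data.List.Base as List using (List; []; _∷_)
open import Data.List.Membership.Propositional using () renaming (_∈_ to _∈ᴸ_)
open import Data.List.Membership.Propositional.Properties using (∈-filter⁺; ∈-map⁺; ∈-++⁺ˡ; ∈-++⁺ʳ)
open import Data.List.Relation.Unary.All as All using (All)
open import Data.List.Relation.Unary.Any using (here)
open import Data.Nat using (ℕ; zero; suc; _+_; _*_; _∸_; _^_; _≤_; _<_; z≤n; s≤s)
open import Data.Nat.DivMod using (_/_; _%_; [m+kn]%n≡m%n; m<n⇒m%n≡m)
import Data.Nat.Properties as ℕ
open import Data.Nat.Tactic.RingSolver using (solve-∀)
import Data.Product.Base as Product
open import Data.Product.Base using (∃; _×_; _,_; proj₁; proj₂)
open import Data.Product.Properties using (≡-dec)
import Data.Sum.Base as Sum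
open import Data.Sum.Base using (_⊎_; inj₁; inj₂; [_,_]′)
open import Data.Vec.Base as Vec using (Vec; []; _∷_; _++_; map; lookup; tabulate; _[_]≔_; sum)
import Data.Vec.Properties as Vec
open import Function.Base using (_∘_)
open import Function.Definitions using (Injective)
open import Relation.Binary.PropositionalEquality
open import Relation.Nullary
open import Relation.Nullary.Decidable using (dec-true; dec-false; from-yes)

-- Degrees and weights of edge sets

Edges : ℕ → ℕ → Set
Edges n m = Vec (Fin n × Fin n) m

hit : ∀ {n} → Fin n → Fin n → ℕ
hit u v = if does (u ≟ v) then 1 else 0

hits : ∀ {n} → Bool → Fin n × Fin n → Fin n → ℕ
hits true  (a , b) v = hit a v + hit b v
hits false _       v = 0

-- Recursion along the edge list, where `degree` counts intersections: this form splits along `++`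
-- and evaluates on the concrete fan. `deg≡degree` links the two.
deg : ∀ {n m} → Edges n m → Subset m → Fin n → ℕ
deg []       []      v = 0
deg (x ∷ es) (s ∷ E) v = hits s x v + deg es E v

-- An edge with entry x in the vector stands for a path of x + 1 edges.
part : Bool → ℕ → ℕ
part true  x = suc x
part false x = 0

weight : ∀ {m} → Vec ℕ m → Subset m → ℕ
weight []       []      = 0
weight (x ∷ xs) (s ∷ E) = part s x + weight xs E

ZeroOrTwo : ℕ → Set
ZeroOrTwo d = d ≡ 0 ⊎ d ≡ 2

hit-≡ : ∀ {n} {u v : Fin n} → u ≡ v → hit u v ≡ 1
hit-≡ {u = u} {v} eq = cong (λ b → if b then 1 else 0) (dec-true (u ≟ v) eq)

hit-≢ : ∀ {n} {u v : Fin n} → u ≢ v → hit u v ≡ 0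
hit-≢ {u = u} {v} ne = cong (λ b → if b then 1 else 0) (dec-false (u ≟ v) ne)

hit-injective : ∀ {n n′} {g : Fin n → Fin n′} → Injective _≡_ _≡_ g → ∀ u v → hit (g u) (g v) ≡ hit u v
hit-injective {g = g} inj u v with u ≟ v
... | yes eq = hit-≡ (cong g eq)
... | no ne  = hit-≢ (ne ∘ inj)

relabel : ∀ {n n′ m} → (Fin n → Fin n′) → Edges n m → Edges n′ m
relabel g = map (Product.map g g)

deg-relabel : ∀ {n n′ m} {g : Fin n → Fin n′} → Injective _≡_ _≡_ g → ∀ (es : Edges n m) E v →
              deg (relabel g es) E (g v) ≡ deg es E v
deg-relabel inj [] [] v = refl
deg-relabel {g = g} inj ((a , b) ∷ es) (true ∷ E) v =
  cong₂ _+_ (cong₂ _+_ (hit-injective {g = g} inj a v) (hit-injective {g = g} inj b v))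
            (deg-relabel inj es E v)
deg-relabel inj (x ∷ es) (false ∷ E) v = deg-relabel inj es E v

deg-relabel-∉ : ∀ {n n′ m} {g : Fin n → Fin n′} {v} → (∀ u → g u ≢ v) → ∀ (es : Edges n m) E →
                deg (relabel g es) E v ≡ 0
deg-relabel-∉ out [] [] = refl
deg-relabel-∉ out ((a , b) ∷ es) (true ∷ E) =
  cong₂ _+_ (cong₂ _+_ (hit-≢ (out a)) (hit-≢ (out b))) (deg-relabel-∉ out es E)
deg-relabel-∉ out (x ∷ es) (false ∷ E) = deg-relabel-∉ out es E

deg-++ : ∀ {n m m′} (es : Edges n m) (es′ : Edges n m′) E E′ v →
         deg (es ++ es′) (E ++ E′) v ≡ deg es E v + deg es′ E′ v
deg-++ []       es′ []      E′ v = refl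
deg-++ (x ∷ es) es′ (s ∷ E) E′ v =
  trans (cong (hits s x v +_) (deg-++ es es′ E E′ v)) (sym (ℕ.+-assoc (hits s x v) _ _))

weight-++ : ∀ {m m′} (xs : Vec ℕ m) (ys : Vec ℕ m′) E E′ →
            weight (xs ++ ys) (E ++ E′) ≡ weight xs E + weight ys E′
weight-++ []       ys []      E′ = refl
weight-++ (x ∷ xs) ys (s ∷ E) E′ =
  trans (cong (part s x +_) (weight-++ xs ys E E′)) (sym (ℕ.+-assoc (part s x) _ _))

deg-⊥ : ∀ {n m} (es : Edges n m) v → deg es ⊥ v ≡ 0
deg-⊥ []       v = refl
deg-⊥ (x ∷ es) v = deg-⊥ es v

weight-⊥ : ∀ {m} (xs : Vec ℕ m) → weight xs ⊥ ≡ 0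
weight-⊥ []       = refl
weight-⊥ (x ∷ xs) = weight-⊥ xs

-- The contribution of the replaced edge is added on the left, which avoids truncated subtraction;
-- likewise in `weight-≔`.
deg-≔ : ∀ {n m} (es : Edges n m) E i y v →
        deg (es [ i ]≔ y) E v + hits (lookup E i) (lookup es i) v ≡ deg es E v + hits (lookup E i) y v
deg-≔ (x ∷ es) (s ∷ E) zero y v = swap (hits s y v) (deg es E v) (hits s x v)
  where
  swap : ∀ p q r → p + q + r ≡ r + q + p
  swap = solve-∀
deg-≔ (x ∷ es) (s ∷ E) (suc i) y v = begin
  hits s x v + deg (es [ i ]≔ y) E v + hits (lookup E i) (lookup es i) v   ≡⟨ ℕ.+-assoc (hits s x v) _ _ ⟩
  hits s x v + (deg (es [ i ]≔ y) E v + hits (lookup E i) (lookup es i) v) ≡⟨ cong (hits s x v +_)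
                                                                                (deg-≔ es E i y v) ⟩
  hits s x v + (deg es E v + hits (lookup E i) y v)                        ≡⟨ ℕ.+-assoc (hits s x v) _ _ ⟨
  hits s x v + deg es E v + hits (lookup E i) y v                          ∎
  where open ≡-Reasoning

weight-≔ : ∀ {m} (xs : Vec ℕ m) E i y →
           weight (xs [ i ]≔ y) E + part (lookup E i) (lookup xs i) ≡ weight xs E + part (lookup E i) y
weight-≔ (x ∷ xs) (s ∷ E) zero y = swap (part s y) (weight xs E) (part s x)
  where
  swap : ∀ p q r → p + q + r ≡ r + q + p
  swap = solve-∀
weight-≔ (x ∷ xs) (s ∷ E) (suc i) y = begin
  part s x + weight (xs [ i ]≔ y) E + part (lookup E i) (lookup xs i)   ≡⟨ ℕ.+-assoc (part s x) _ _ ⟩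
  part s x + (weight (xs [ i ]≔ y) E + part (lookup E i) (lookup xs i)) ≡⟨ cong (part s x +_)
                                                                             (weight-≔ xs E i y) ⟩
  part s x + (weight xs E + part (lookup E i) y)                        ≡⟨ ℕ.+-assoc (part s x) _ _ ⟨
  part s x + weight xs E + part (lookup E i) y                          ∎
  where open ≡-Reasoning

-- Subdividing edges

-- Connectedness is not needed: in the graphs below, every nonempty set of edges with all
-- degrees 0 or 2 is a single cycle, because each of its components contains the root.
Separated : ∀ {n m} → Edges n m → Vec ℕ m → Set
Separated es xs = ∀ E F → (∀ v → ZeroOrTwo (deg es E v)) → (∀ v → ZeroOrTwo (deg es F v)) →
                  E ≢ ⊥ → F ≢ ⊥ → weight xs E ≡ weight xs F → E ≡ F

subdivide : ∀ {n m} → Edges n m → Fin m → Edges (suc n) (suc m)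
subdivide es i = (zero , suc (proj₂ (lookup es i))) ∷
                 relabel suc es [ i ]≔ (suc (proj₁ (lookup es i)) , zero)

module _ {n m} (es : Edges n m) (i : Fin m) where

  private
    a = proj₁ (lookup es i)
    b = proj₂ (lookup es i)
    y : Fin (suc n) × Fin (suc n)
    y = suc a , zero

    lookup-relabel : lookup (relabel suc es) i ≡ (suc a , suc b)
    lookup-relabel = Vec.lookup-map i (Product.map suc suc) es

    deg-zero : ∀ E → deg (relabel suc es [ i ]≔ y) E zero ≡ hits (lookup E i) y zero
    deg-zero E = ℕ.+-cancelʳ-≡ 0 _ _ (begin
      deg (relabel suc es [ i ]≔ y) E zero + 0
        ≡⟨ cong (deg (relabel suc es [ i ]≔ y) E zero +_)
             (trans (cong (λ z → hits (lookup E i) z zero) lookup-relabel) (none (lookup E i))) ⟨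
      deg (relabel suc es [ i ]≔ y) E zero + hits (lookup E i) (lookup (relabel suc es) i) zero
        ≡⟨ deg-≔ (relabel suc es) E i y zero ⟩
      deg (relabel suc es) E zero + hits (lookup E i) y zero
        ≡⟨ cong (_+ hits (lookup E i) y zero) (deg-relabel-∉ (λ _ ()) es E) ⟩
      hits (lookup E i) y zero
        ≡⟨ ℕ.+-identityʳ _ ⟨
      hits (lookup E i) y zero + 0 ∎)
      where
      open ≡-Reasoning
      none : ∀ s → hits s (suc a , suc b) zero ≡ 0
      none true  = refl
      none false = refl

  -- The new vertex meets only the two halves of edge `i`, so degree 0 or 2 there means that both
  -- halves are chosen or neither is.
  subdivide-agree : ∀ s E → ZeroOrTwo (deg (subdivide es i) (s ∷ E) zero) → s ≡ lookup E i
  subdivide-agree s E d = agree s (lookup E i)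
    (subst ZeroOrTwo (cong (hits s (zero , suc b) zero +_) (deg-zero E)) d)
    where
    agree : ∀ s s′ → ZeroOrTwo (hits s (zero {n} , suc b) zero + hits s′ y zero) → s ≡ s′
    agree true  true  _ = refl
    agree false false _ = refl
    agree true  false (inj₁ ())
    agree true  false (inj₂ ())
    agree false true  (inj₁ ())
    agree false true  (inj₂ ())

  deg-subdivide : ∀ E v → deg (subdivide es i) (lookup E i ∷ E) (suc v) ≡ deg es E v
  deg-subdivide E v = ℕ.+-cancelʳ-≡ (hits s y (suc v)) _ _ (begin
    hits s (zero , suc b) (suc v) + D + hits s y (suc v)  ≡⟨ merge s ⟩
    D + hits s (suc a , suc b) (suc v)                    ≡⟨ cong (λ z → D + hits s z (suc v)) lookup-relabel ⟨
    D + hits s (lookup (relabel suc es) i) (suc v)        ≡⟨ deg-≔ (relabel suc es) E i y (suc v) ⟩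
    deg (relabel suc es) E (suc v) + hits s y (suc v)     ≡⟨ cong (_+ hits s y (suc v))
                                                                (deg-relabel suc-injective es E v) ⟩
    deg es E v + hits s y (suc v)                         ∎)
    where
    open ≡-Reasoning
    s = lookup E i
    D = deg (relabel suc es [ i ]≔ y) E (suc v)
    shuffle : ∀ p q d → p + d + (q + 0) ≡ d + (q + p)
    shuffle = solve-∀
    merge : ∀ s → hits s (zero , suc b) (suc v) + D + hits s y (suc v) ≡ D + hits s (suc a , suc b) (suc v)
    merge true  = shuffle (hit (suc b) (suc v)) (hit (suc a) (suc v)) D
    merge false = refl

  -- A path of x + 2 edges splits into a single edge and a path of x + 1 edges.
  weight-subdivide : ∀ xs x E → lookup xs i ≡ suc x →
                     weight (0 ∷ xs [ i ]≔ x) (lookup E i ∷ E) ≡ weight xs E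
  weight-subdivide xs x E eq = ℕ.+-cancelʳ-≡ (part s x) _ _ (begin
    part s 0 + W + part s x   ≡⟨ merge s ⟩
    W + part s (suc x)        ≡⟨ cong (λ z → W + part s z) eq ⟨
    W + part s (lookup xs i)  ≡⟨ weight-≔ xs E i x ⟩
    weight xs E + part s x    ∎)
    where
    open ≡-Reasoning
    s = lookup E i
    W = weight (xs [ i ]≔ x) E
    shuffle : ∀ w x → suc w + suc x ≡ w + suc (suc x)
    shuffle = solve-∀
    merge : ∀ s → part s 0 + W + part s x ≡ W + part s (suc x)
    merge true  = shuffle W x
    merge false = refl

  -- By `subdivide-agree`, the edge sets with all degrees 0 or 2 come from edge sets of the old
  -- graph, with the same degrees at the old vertices and the same weight.
  subdivide-separated : ∀ {xs x} → lookup xs i ≡ suc x →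
                        Separated es xs → Separated (subdivide es i) (0 ∷ xs [ i ]≔ x)
  subdivide-separated {xs} {x} eq sep (s ∷ E) (s′ ∷ F) dE dF E≢⊥ F≢⊥ same
    with refl ← subdivide-agree s E (dE zero) | refl ← subdivide-agree s′ F (dF zero) =
    cong (λ E → lookup E i ∷ E) (sep E F (old E dE) (old F dF) (nonempty E E≢⊥) (nonempty F F≢⊥)
      (trans (sym (weight-subdivide xs x E eq)) (trans same (weight-subdivide xs x F eq))))
    where
    old : ∀ E → (∀ v → ZeroOrTwo (deg (subdivide es i) (lookup E i ∷ E) v)) → ∀ v → ZeroOrTwo (deg es E v)
    old E d v = subst ZeroOrTwo (deg-subdivide E v) (d (suc v))
    nonempty : ∀ E → lookup E i ∷ E ≢ ⊥ → E ≢ ⊥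
    nonempty E ne refl = ne (cong (_∷ ⊥) (Vec.lookup-replicate i false))

-- From edge sets to cycles

deg≡degree : ∀ {n m} (es : Edges n m) E v →
  ∣ E ∩ tabulate (λ e → does (proj₁ (lookup es e) ≟ v)) ∣ +
  ∣ E ∩ tabulate (λ e → does (proj₂ (lookup es e) ≟ v)) ∣ ≡ deg es E v
deg≡degree []             []          v = refl
deg≡degree (x ∷ es)       (false ∷ E) v = deg≡degree es E v
deg≡degree ((a , b) ∷ es) (true ∷ E)  v with deg≡degree es E v | does (a ≟ v) | does (b ≟ v)
... | ih | true  | true  = cong suc (trans (ℕ.+-suc _ _) (cong suc ih))
... | ih | true  | false = cong suc ih
... | ih | false | true  = trans (ℕ.+-suc _ _) (cong suc ih)
... | ih | false | false = ih

weight≡size : ∀ {m} (xs : Vec ℕ m) → sum xs ≡ 0 → ∀ E → weight xs E ≡ ∣ E ∣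
weight≡size []         eq []          = refl
weight≡size (zero ∷ xs) eq (true ∷ E)  = cong suc (weight≡size xs eq E)
weight≡size (zero ∷ xs) eq (false ∷ E) = weight≡size xs eq E

module _ {n m} (es : Edges n m) where

  graph : Graph n m
  graph = record { ends = lookup es }

  open Subgraph

  deg-cycle : ∀ (C : Subgraph graph) → IsCycle C → ∀ v →
              (v ∈ vertices C × deg es (edges C) v ≡ 2) ⊎ deg es (edges C) v ≡ 0
  deg-cycle C c v with v ∈? vertices C
  ... | yes p = inj₁ (p , trans (sym (deg≡degree es (edges C) v)) (IsCycle.regular c v p))
  ... | no ¬p = inj₂ (trans (sym (deg≡degree es (edges C) v)) (cong₂ _+_
    (∣∩∣-empty λ {e} q → ∉-tabulate⁺ {G = graph} {h = Graph.start graph}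
      λ eq → ¬p (subst (_∈ vertices C) eq (proj₁ (closed C e q))))
    (∣∩∣-empty λ {e} q → ∉-tabulate⁺ {G = graph} {h = Graph.end graph}
      λ eq → ¬p (subst (_∈ vertices C) eq (proj₂ (closed C e q))))))

  -- The vertices of a cycle are those of nonzero degree, so the edge set determines them.
  cycle-vertices : ∀ (C D : Subgraph graph) → IsCycle C → IsCycle D → edges C ≡ edges D →
                   vertices C ⊆ vertices D
  cycle-vertices C D c d eq {v} p with deg-cycle D d v
  ... | inj₁ (q , _) = q
  ... | inj₂ deg≡0 with () ← trans (sym (IsCycle.regular c v p)) (trans (deg≡degree es (edges C) v)
                              (trans (cong (λ E → deg es E v) eq) deg≡0))

  separated⇒distinct : ∀ xs → sum xs ≡ 0 → Separated es xs → DistinctCycleLengths graph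
  separated⇒distinct xs xs≡0 sep C D c d C≢D same =
    C≢D (⊆-antisym (cycle-vertices C D c d E≡F) (cycle-vertices D C d c (sym E≡F)) , E≡F)
    where
    zeroOrTwo : ∀ C → IsCycle C → ∀ v → ZeroOrTwo (deg es (edges C) v)
    zeroOrTwo C c v with deg-cycle C c v
    ... | inj₁ (_ , eq) = inj₂ eq
    ... | inj₂ eq       = inj₁ eq
    nonempty : ∀ C → IsCycle C → edges C ≢ ⊥
    nonempty C c eq with v , p ← IsConnected.nonempty (IsCycle.connected c)
      with () ← trans (sym (IsCycle.regular c v p)) (trans (deg≡degree es (edges C) v)
                  (trans (cong (λ E → deg es E v) eq) (deg-⊥ es v)))
    E≡F : edges C ≡ edges D
    E≡F = sep (edges C) (edges D) (zeroOrTwo C c) (zeroOrTwo D d) (nonempty C c) (nonempty D d)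
      (trans (weight≡size xs xs≡0 (edges C)) (trans same (sym (weight≡size xs xs≡0 (edges D)))))

sum-≔ : ∀ {m} (xs : Vec ℕ m) i {x} → lookup xs i ≡ suc x → suc (sum (xs [ i ]≔ x)) ≡ sum xs
sum-≔ (_ ∷ xs) zero    refl = refl
sum-≔ (y ∷ xs) (suc i) eq   = trans (sym (ℕ.+-suc y _)) (cong (y +_) (sum-≔ xs i eq))

positive-entry : ∀ {m k} (xs : Vec ℕ m) → sum xs ≡ suc k → ∃ λ i → ∃ λ x → lookup xs i ≡ suc x
positive-entry (suc x ∷ xs) eq = zero , x , refl
positive-entry (zero  ∷ xs) eq with i , x , p ← positive-entry xs eq = suc i , x , p

-- Each subdivision lowers one entry by 1 and adds one vertex and one edge. Once all entries are 0,
-- the weight of an edge set is its size.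
separated⇒admissible : ∀ k {n m} (es : Edges n m) xs → sum xs ≡ k → Separated es xs →
                       Admissible (k + n) (k + m)
separated⇒admissible zero    es xs eq sep = graph es , separated⇒distinct es xs eq sep
separated⇒admissible (suc k) es xs eq sep with i , x , p ← positive-entry xs eq =
  subst₂ Admissible (ℕ.+-suc k _) (ℕ.+-suc k _)
    (separated⇒admissible k (subdivide es i) (0 ∷ xs [ i ]≔ x)
      (ℕ.suc-injective (trans (sum-≔ xs i p) eq)) (subdivide-separated es i p sep))

-- Graphs with a root

RegularOffRoot : ∀ {n m} → Edges (suc n) m → Subset m → Set
RegularOffRoot es E = ∀ v → ZeroOrTwo (deg es E (suc v))

-- `S` contains all cycle lengths, and every cycle passes through the root. Root degrees add up when
-- roots are identified, so `classify` assumes only the bound 2, which both halves of a wedge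
-- inherit.
record Spectrum {n m} (es : Edges (suc n) m) (xs : Vec ℕ m) (S : ℕ → Set) : Set where
  field
    classify : ∀ E → RegularOffRoot es E → deg es E zero ≤ 2 →
               E ≡ ⊥ ⊎ (deg es E zero ≡ 2 × S (weight xs E))
    unique   : ∀ E F → RegularOffRoot es E → RegularOffRoot es F →
               deg es E zero ≡ 2 → deg es F zero ≡ 2 → weight xs E ≡ weight xs F → E ≡ F

open Spectrum

-- Root degree 0 would make the edge set empty by `classify`, so both sets have root degree 2 and
-- `unique` applies.
spectrum⇒separated : ∀ {n m S} {es : Edges (suc n) m} {xs} → Spectrum es xs S → Separated es xs
spectrum⇒separated {es = es} sp E F dE dF E≢⊥ F≢⊥ =
  unique sp E F (dE ∘ suc) (dF ∘ suc) (two E dE E≢⊥) (two F dF F≢⊥)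
  where
  two : ∀ E → (∀ v → ZeroOrTwo (deg es E v)) → E ≢ ⊥ → deg es E zero ≡ 2
  two E d E≢⊥ with d zero
  ... | inj₂ eq = eq
  ... | inj₁ eq with classify sp E (d ∘ suc) (subst (_≤ 2) (sym eq) z≤n)
  ...   | inj₁ E≡⊥      = contradiction E≡⊥ E≢⊥
  ...   | inj₂ (eq′ , _) with () ← trans (sym eq) eq′

widen : ∀ {n m S S′} {es : Edges (suc n) m} {xs} → (∀ {ℓ} → S ℓ → S′ ℓ) →
        Spectrum es xs S → Spectrum es xs S′
widen f sp = record
  { classify = λ E r d → Sum.map₂ (λ (eq , s) → eq , f s) (classify sp E r d)
  ; unique   = unique sp
  }

⊥-++ : ∀ m {m′} → ⊥ {m} ++ ⊥ {m′} ≡ ⊥ {m + m′}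
⊥-++ zero    = refl
⊥-++ (suc m) = cong (false ∷_) (⊥-++ m)

-- Identifying the roots of two graphs

module _ {n n′ : ℕ} where

  left : Fin (suc n) → Fin (suc (n + n′))
  left zero    = zero
  left (suc v) = suc (v ↑ˡ n′)

  right : Fin (suc n′) → Fin (suc (n + n′))
  right zero    = zero
  right (suc v) = suc (n ↑ʳ v)

  left-injective : Injective _≡_ _≡_ left
  left-injective {zero}  {zero}  _  = refl
  left-injective {suc u} {suc v} eq = cong suc (↑ˡ-injective n′ u v (suc-injective eq))

  right-injective : Injective _≡_ _≡_ right
  right-injective {zero}  {zero}  _  = refl
  right-injective {suc u} {suc v} eq = cong suc (↑ʳ-injective n u v (suc-injective eq))

  ↑ˡ≢↑ʳ : ∀ (u : Fin n) (v : Fin n′) → u ↑ˡ n′ ≢ n ↑ʳ v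
  ↑ˡ≢↑ʳ u v eq with () ←
    trans (sym (splitAt-↑ˡ n u n′)) (trans (cong (splitAt n) eq) (splitAt-↑ʳ n n′ v))

  left∌ : ∀ v u → left u ≢ suc (n ↑ʳ v)
  left∌ v (suc u) eq = ↑ˡ≢↑ʳ u v (suc-injective eq)

  right∌ : ∀ v u → right u ≢ suc (v ↑ˡ n′)
  right∌ v (suc u) eq = ↑ˡ≢↑ʳ v u (sym (suc-injective eq))

module _ {n n′ m m′} (es : Edges (suc n) m) (es′ : Edges (suc n′) m′) where

  wedge : Edges (suc (n + n′)) (m + m′)
  wedge = relabel left es ++ relabel right es′

  module _ (E : Subset m) (E′ : Subset m′) where

    deg-wedge-root : deg wedge (E ++ E′) zero ≡ deg es E zero + deg es′ E′ zero
    deg-wedge-root = trans (deg-++ (relabel left es) (relabel right es′) E E′ zero)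
      (cong₂ _+_ (deg-relabel left-injective es E zero) (deg-relabel right-injective es′ E′ zero))

    deg-wedge-left : ∀ v → deg wedge (E ++ E′) (suc (v ↑ˡ n′)) ≡ deg es E (suc v)
    deg-wedge-left v = trans (deg-++ (relabel left es) (relabel right es′) E E′ _)
      (trans (cong₂ _+_ (deg-relabel left-injective es E (suc v)) (deg-relabel-∉ (right∌ v) es′ E′))
             (ℕ.+-identityʳ _))

    deg-wedge-right : ∀ v → deg wedge (E ++ E′) (suc (n ↑ʳ v)) ≡ deg es′ E′ (suc v)
    deg-wedge-right v = trans (deg-++ (relabel left es) (relabel right es′) E E′ _)
      (cong₂ _+_ (deg-relabel-∉ (left∌ v) es E) (deg-relabel right-injective es′ E′ (suc v)))

    regular-left : RegularOffRoot wedge (E ++ E′) → RegularOffRoot es E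
    regular-left r v = subst ZeroOrTwo (deg-wedge-left v) (r (v ↑ˡ n′))

    regular-right : RegularOffRoot wedge (E ++ E′) → RegularOffRoot es′ E′
    regular-right r v = subst ZeroOrTwo (deg-wedge-right v) (r (n ↑ʳ v))

  module _ {xs : Vec ℕ m} {xs′ : Vec ℕ m′} {S S′ : ℕ → Set}
           (sp : Spectrum es xs S) (sp′ : Spectrum es′ xs′ S′)
           (disjoint : ∀ {ℓ} → S ℓ → ¬ S′ ℓ) where

    private
      w : Subset m → ℕ
      w = weight xs
      w′ : Subset m′ → ℕ
      w′ = weight xs′

      data Side (E : Subset m) (E′ : Subset m′) : Set where
        neither : E ≡ ⊥ → E′ ≡ ⊥ → Side E E′
        onLeft  : deg es E zero ≡ 2 → S (w E) → E′ ≡ ⊥ → Side E E′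
        onRight : E ≡ ⊥ → deg es′ E′ zero ≡ 2 → S′ (w′ E′) → Side E E′

      -- Each nonempty half already has root degree 2, so two nonempty halves would give the root
      -- degree 4.
      side : ∀ E E′ → RegularOffRoot wedge (E ++ E′) → deg wedge (E ++ E′) zero ≤ 2 → Side E E′
      side E E′ r d with d′ ← subst (_≤ 2) (deg-wedge-root E E′) d
        with classify sp E (regular-left E E′ r) (ℕ.≤-trans (ℕ.m≤m+n _ _) d′)
           | classify sp′ E′ (regular-right E E′ r) (ℕ.≤-trans (ℕ.m≤n+m _ _) d′)
      ... | inj₁ p       | inj₁ q         = neither p q
      ... | inj₂ (p , s) | inj₁ q         = onLeft p s q
      ... | inj₁ p       | inj₂ (q , s)   = onRight p q s
      ... | inj₂ (p , _) | inj₂ (q , _) with s≤s (s≤s ()) ← subst₂ (λ a b → a + b ≤ 2) p q d′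

      weight-left : ∀ {E E′} → E′ ≡ ⊥ → weight (xs ++ xs′) (E ++ E′) ≡ w E
      weight-left {E} {E′} refl = trans (weight-++ xs xs′ E E′)
        (trans (cong (w E +_) (weight-⊥ xs′)) (ℕ.+-identityʳ _))

      weight-right : ∀ {E E′} → E ≡ ⊥ → weight (xs ++ xs′) (E ++ E′) ≡ w′ E′
      weight-right {E} {E′} refl = trans (weight-++ xs xs′ E E′) (cong (_+ w′ E′) (weight-⊥ xs))

      root-empty : deg wedge (⊥ {m} ++ ⊥ {m′}) zero ≢ 2
      root-empty eq with () ← trans (sym eq)
        (trans (cong (λ E → deg wedge E zero) (⊥-++ m)) (deg-⊥ wedge zero))

    wedge-spectrum : Spectrum wedge (xs ++ xs′) (λ ℓ → S ℓ ⊎ S′ ℓ)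
    wedge-spectrum .classify E₀ r d with E , E′ , refl ← Vec.splitAt m E₀ with side E E′ r d
    ... | neither refl refl = inj₁ (⊥-++ m)
    ... | onLeft p s refl = inj₂
      ( trans (deg-wedge-root E ⊥) (cong₂ _+_ p (deg-⊥ es′ zero))
      , inj₁ (subst S (sym (weight-left refl)) s))
    ... | onRight refl p s = inj₂
      ( trans (deg-wedge-root ⊥ E′) (cong₂ _+_ (deg-⊥ es zero) p)
      , inj₂ (subst S′ (sym (weight-right {E′ = E′} refl)) s))
    wedge-spectrum .unique E₀ F₀ rE rF dE dF eq
      with E , E′ , refl ← Vec.splitAt m E₀ | F , F′ , refl ← Vec.splitAt m F₀
      with side E E′ rE (ℕ.≤-reflexive dE) | side F F′ rF (ℕ.≤-reflexive dF)
    ... | neither refl refl | _ = contradiction dE root-empty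
    ... | onLeft _ _ _      | neither refl refl = contradiction dF root-empty
    ... | onRight _ _ _     | neither refl refl = contradiction dF root-empty
    ... | onLeft p _ refl   | onLeft q _ refl = cong (_++ ⊥)
      (unique sp E F (regular-left E ⊥ rE) (regular-left F ⊥ rF) p q
        (trans (sym (weight-left refl)) (trans eq (weight-left refl))))
    ... | onRight refl p _  | onRight refl q _ = cong (⊥ {m} ++_)
      (unique sp′ E′ F′ (regular-right ⊥ E′ rE) (regular-right ⊥ F′ rF) p q
        (trans (sym (weight-right refl)) (trans eq (weight-right refl))))
    -- Cycles on opposite sides with equal weight would put one length into both `S` and `S′`.
    ... | onLeft _ s refl   | onRight refl _ s′ = contradiction
      (subst S′ (trans (sym (weight-right {E′ = F′} refl)) (trans (sym eq) (weight-left refl))) s′) (disjoint s)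
    ... | onRight refl _ s′ | onLeft _ s refl = contradiction
      (subst S′ (trans (sym (weight-right {E′ = E′} refl)) (trans eq (weight-left refl))) s′) (disjoint s)

-- Bouquets: rooted graphs with their vertex and cycle counts

-- After subdivision there are a vertices besides the root, and a + c edges.
record Bouquet (S : ℕ → Set) (a c : ℕ) : Set where
  field
    {n m}    : ℕ
    es       : Edges (suc n) m
    xs       : Vec ℕ m
    spectrum : Spectrum es xs S
    vertices : sum xs + n ≡ a
    excess   : m ≡ n + c

widenᴮ : ∀ {S S′ a c} → (∀ {ℓ} → S ℓ → S′ ℓ) → Bouquet S a c → Bouquet S′ a c
widenᴮ f B = record
  { es = B.es ; xs = B.xs ; spectrum = widen f B.spectrum ; vertices = B.vertices ; excess = B.excess }
  where module B = Bouquet B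

sum-++ : ∀ {m m′} (xs : Vec ℕ m) (ys : Vec ℕ m′) → sum (xs ++ ys) ≡ sum xs + sum ys
sum-++ []       ys = refl
sum-++ (x ∷ xs) ys = trans (cong (x +_) (sum-++ xs ys)) (sym (ℕ.+-assoc x (sum xs) (sum ys)))

infixr 5 _∨_[_]
_∨_[_] : ∀ {S S′ a a′ c c′} → Bouquet S a c → Bouquet S′ a′ c′ → (∀ {ℓ} → S ℓ → ¬ S′ ℓ) →
         Bouquet (λ ℓ → S ℓ ⊎ S′ ℓ) (a + a′) (c + c′)
_∨_[_] {c = c} {c′} B B′ disjoint = record
  { es       = wedge B.es B′.es
  ; xs       = B.xs ++ B′.xs
  ; spectrum = wedge-spectrum B.es B′.es B.spectrum B′.spectrum disjoint
  ; vertices = trans (cong (_+ (B.n + B′.n)) (sum-++ B.xs B′.xs))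
                 (trans (interchange (sum B.xs) (sum B′.xs) B.n B′.n) (cong₂ _+_ B.vertices B′.vertices))
  ; excess   = trans (cong₂ _+_ B.excess B′.excess) (interchange B.n c B′.n c′)
  }
  where
  module B  = Bouquet B
  module B′ = Bouquet B′
  interchange : ∀ p q r s → (p + q) + (r + s) ≡ (p + r) + (q + s)
  interchange = solve-∀

-- Carrying out all subdivisions adds `sum xs` vertices and as many edges, so the excess `c` is
-- preserved; the root is the one extra vertex.
bouquet⇒admissible : ∀ {S a c} → Bouquet S a c → Admissible (suc a) (a + c)
bouquet⇒admissible {a = a} {c} B = subst₂ Admissible
  (trans (ℕ.+-suc _ _) (cong suc B.vertices))
  (trans (cong (sum B.xs +_) B.excess) (trans (sym (ℕ.+-assoc (sum B.xs) B.n c)) (cong (_+ c) B.vertices)))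
  (separated⇒admissible (sum B.xs) B.es B.xs refl (spectrum⇒separated B.spectrum))
  where module B = Bouquet B

-- Single cycles and pendant paths

loop-block : ∀ k → Bouquet (_≡ suc k) k 1
loop-block k = record
  { es = (zero , zero) ∷ [] ; xs = k ∷ [] ; spectrum = sp
  ; vertices = trans (ℕ.+-identityʳ _) (ℕ.+-identityʳ k) ; excess = refl }
  where
  sp : Spectrum ((zero , zero) ∷ []) (k ∷ []) (_≡ suc k)
  sp .classify (true  ∷ []) _ _ = inj₂ (refl , cong suc (ℕ.+-identityʳ k))
  sp .classify (false ∷ []) _ _ = inj₁ refl
  sp .unique (true ∷ []) (true ∷ []) _ _ _ _ _ = refl

no-cycle : ℕ → Set
no-cycle _ = Empty.⊥

-- Pads the vertex count without creating a cycle: the free end of the path has degree 1 as soon as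
-- the path is chosen.
pendant-block : ∀ k → Bouquet no-cycle (suc k) 0
pendant-block k = record
  { es = (zero , suc zero) ∷ [] ; xs = k ∷ [] ; spectrum = sp
  ; vertices = trans (cong (_+ 1) (ℕ.+-identityʳ k)) (ℕ.+-comm k 1) ; excess = refl }
  where
  sp : Spectrum ((zero , suc zero) ∷ []) (k ∷ []) no-cycle
  sp .classify (true  ∷ []) r _ = Empty.⊥-elim ([ (λ ()) , (λ ()) ]′ (r zero))
  sp .classify (false ∷ []) _ _ = inj₁ refl
  sp .unique (true  ∷ []) _ r _ _ _ _ = Empty.⊥-elim ([ (λ ()) , (λ ()) ]′ (r zero))
  sp .unique (false ∷ []) _ _ _ () _ _

point : Bouquet no-cycle 0 0
point = record { es = [] ; xs = [] ; spectrum = sp ; vertices = refl ; excess = refl }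
  where
  sp : Spectrum {n = 0} [] [] no-cycle
  sp .classify [] _ _ = inj₁ refl
  sp .unique [] [] _ _ _ _ _ = refl

loops-size : ℕ → ℕ
loops-size zero    = 0
loops-size (suc k) = loops-size k + k

-- One cycle of each length 1, ..., k. The upper bound `_≤ k` is all that is needed to keep them
-- apart from longer cycles.
loops : ∀ k → Bouquet (_≤ k) (loops-size k) k
loops zero    = widenᴮ Empty.⊥-elim point
loops (suc k) = subst (Bouquet _ _) (ℕ.+-comm k 1)
  (widenᴮ [ ℕ.m≤n⇒m≤1+n , ℕ.≤-reflexive ]′
    (loops k ∨ loop-block k [ (λ p q → ℕ.<-irrefl refl (subst (_≤ k) q p)) ]))

-- Symbolic lengths and enumeration of edge sets

-- The triple (a, b, c) stands for the polynomial au + bi + c. With symbolic lengths, one finite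
-- check settles the fans for all u and i.
Form : Set
Form = ℕ × ℕ × ℕ

_≟ᶠ_ : (φ ψ : Form) → Dec (φ ≡ ψ)
_≟ᶠ_ = ≡-dec ℕ._≟_ (≡-dec ℕ._≟_ ℕ._≟_)

_⊕_ : Form → Form → Form
(a , b , c) ⊕ (a′ , b′ , c′) = a + a′ , b + b′ , c + c′

eval : ℕ → ℕ → Form → ℕ
eval u i (a , b , c) = a * u + b * i + c

eval-⊕ : ∀ u i φ ψ → eval u i (φ ⊕ ψ) ≡ eval u i φ + eval u i ψ
eval-⊕ u i (a , b , c) (a′ , b′ , c′) = distrib a b c a′ b′ c′ u i
  where
  distrib : ∀ a b c a′ b′ c′ u i →
            (a + a′) * u + (b + b′) * i + (c + c′) ≡ (a * u + b * i + c) + (a′ * u + b′ * i + c′)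
  distrib = solve-∀

form-part : Bool → Form → Form
form-part true  (a , b , c) = a , b , suc c
form-part false _           = 0 , 0 , 0

form-weight : ∀ {m} → Vec Form m → Subset m → Form
form-weight []       []      = 0 , 0 , 0
form-weight (φ ∷ φs) (s ∷ E) = form-part s φ ⊕ form-weight φs E

weight-eval : ∀ u i {m} (φs : Vec Form m) E →
              weight (map (eval u i) φs) E ≡ eval u i (form-weight φs E)
weight-eval u i []       []      = refl
weight-eval u i (φ ∷ φs) (s ∷ E) = trans
  (cong₂ _+_ (part-eval s) (weight-eval u i φs E)) (sym (eval-⊕ u i (form-part s φ) (form-weight φs E)))
  where
  part-eval : ∀ s → part s (eval u i φ) ≡ eval u i (form-part s φ)
  part-eval true  = sym (ℕ.+-suc _ _)
  part-eval false = refl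

subsets : ∀ m → List (Subset m)
subsets zero    = [] ∷ []
subsets (suc m) = List.map (true ∷_) (subsets m) List.++ List.map (false ∷_) (subsets m)

∈-subsets : ∀ {m} (E : Subset m) → E ∈ᴸ subsets m
∈-subsets []          = here refl
∈-subsets (true  ∷ E) = ∈-++⁺ˡ (∈-map⁺ (true ∷_) (∈-subsets E))
∈-subsets {suc m} (false ∷ E) = ∈-++⁺ʳ (List.map (true ∷_) (subsets m)) (∈-map⁺ (false ∷_) (∈-subsets E))

_≟ˢ_ : ∀ {m} (E F : Subset m) → Dec (E ≡ F)
_≟ˢ_ = Vec.≡-dec _≟ᴮ_

-- Fans

-- The root is 0 and the path is 1, …, 5; the first and the last edge are the spokes 0 and 6
-- together with the adjacent ends of the path.
fan-edges : Edges 6 11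
fan-edges =
  (# 0 , # 1) ∷
  (# 0 , # 1) ∷ (# 0 , # 2) ∷ (# 0 , # 3) ∷ (# 0 , # 4) ∷ (# 0 , # 5) ∷
  (# 1 , # 2) ∷ (# 2 , # 3) ∷ (# 3 , # 4) ∷ (# 4 , # 5) ∷
  (# 5 , # 0) ∷ []

-- With a = (0, -1, -3, -4, -8, -9), b = (0, 2, 5, 7, 11, 9) and w = 10u + 2, the cycle through
-- the spokes j < k of fan i has length 42u + 39 + w (a_j + b_k) + ε + 2i, where ε ∈ {0, 1, 2} is
-- odd iff neither or both of j and k belong to {3, 6}.  The forms are one less than the
-- number of edges of each path, in accordance with weight.
fan-forms : Vec Form 11
fan-forms =
  (26 , 1 , 20) ∷
  (16 , 1 , 18) ∷ (16 , 1 , 18) ∷ (26 , 1 , 20) ∷ (16 , 1 , 18) ∷ (31 , 1 , 21) ∷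
  (20 , 0 , 3) ∷ (20 , 0 , 2) ∷ (30 , 0 , 6) ∷ (25 , 0 , 4) ∷
  (11 , 1 , 16) ∷ []

regular? : ∀ {n m} (es : Edges (suc n) m) E → Dec (RegularOffRoot es E)
regular? es E = all? λ v → zeroOrTwo? (deg es E (suc v))
  where
  zeroOrTwo? : ∀ d → Dec (ZeroOrTwo d)
  zeroOrTwo? d = d ℕ.≟ 0 ⊎-dec d ℕ.≟ 2

cycle-length : Subset 11 → Form
cycle-length = form-weight fan-forms

-- The values of a_j + b_k and ε, read off from the length.
slot offset : Subset 11 → ℕ
slot E   = (proj₁ (cycle-length E) ∸ 42) / 10
offset E = proj₂ (proj₂ (cycle-length E)) ∸ (39 + 2 * slot E)

fan-cycle? : ∀ E → Dec (RegularOffRoot fan-edges E × E ≢ ⊥ × deg fan-edges E zero ≤ 2)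
fan-cycle? E = regular? fan-edges E ×-dec ¬? (E ≟ˢ ⊥) ×-dec deg fan-edges E zero ℕ.≤? 2

fan-cycles : List (Subset 11)
fan-cycles = List.filter fan-cycle? (subsets 11)

InSlot : Subset 11 → Set
InSlot E = deg fan-edges E zero ≡ 2 × offset E ≤ 2 ×
           cycle-length E ≡ (42 + 10 * slot E , 2 , 39 + 2 * slot E + offset E)

inSlot? : ∀ E → Dec (InSlot E)
inSlot? E = deg fan-edges E zero ℕ.≟ 2 ×-dec offset E ℕ.≤? 2 ×-dec
            cycle-length E ≟ᶠ (42 + 10 * slot E , 2 , 39 + 2 * slot E + offset E)

-- Checked by evaluation over all edge sets of the fan. The filter admits root degrees 0 and 1 as
-- well, so this also shows that every cycle passes through the root. The coefficient 2 of i comes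
-- from the two spokes of a cycle.
in-slot : All InSlot fan-cycles
in-slot = from-yes (All.all? inSlot? fan-cycles)

-- Checked by evaluation: two cycles of a fan may share a slot, but then their ε have opposite
-- parity.
slots-distinct : All (λ E → All (λ F → slot E ≡ slot F × offset E % 2 ≡ offset F % 2 → E ≡ F)
                                fan-cycles) fan-cycles
slots-distinct = from-yes (All.all? (λ E → All.all? (λ F →
  (slot E ℕ.≟ slot F ×-dec offset E % 2 ℕ.≟ offset F % 2) →-dec E ≟ˢ F) fan-cycles) fan-cycles)

fan-complete : ∀ E → RegularOffRoot fan-edges E → deg fan-edges E zero ≤ 2 → E ≢ ⊥ → E ∈ᴸ fan-cycles
fan-complete E r d E≢⊥ = ∈-filter⁺ fan-cycle? (∈-subsets E) (r , E≢⊥ , d)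

slot-injective : ∀ {E F} → E ∈ᴸ fan-cycles → F ∈ᴸ fan-cycles →
                 slot E ≡ slot F → offset E % 2 ≡ offset F % 2 → E ≡ F
slot-injective p q eq eq′ = All.lookup (All.lookup slots-distinct p) q (eq , eq′)

slot-length : ℕ → ℕ → ℕ → ℕ → ℕ
slot-length u i q e = eval u i (42 + 10 * q , 2 , 39 + 2 * q + e)

-- Past the offset 42u + 39, division by the slot width 10u + 2 has quotient q and, by
-- `offset-bound`, remainder ε + 2i.
slot-length-shape : ∀ u i q e → slot-length u i q e ≡ 42 * u + 39 + ((e + i * 2) + q * (2 + 10 * u))
slot-length-shape = shape
  where
  shape : ∀ u i q e → (42 + 10 * q) * u + 2 * i + (39 + 2 * q + e) ≡
                      42 * u + 39 + ((e + i * 2) + q * (2 + 10 * u))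
  shape = solve-∀

divMod-unique : ∀ w {ρ ρ′} q q′ → ρ < suc w → ρ′ < suc w →
                ρ + q * suc w ≡ ρ′ + q′ * suc w → ρ ≡ ρ′ × q ≡ q′
divMod-unique w {ρ} {ρ′} q q′ ρ< ρ′< eq = ρ≡ρ′ ,
  ℕ.*-cancelʳ-≡ q q′ (suc w) (ℕ.+-cancelˡ-≡ ρ _ _ (trans eq (cong (_+ q′ * suc w) (sym ρ≡ρ′))))
  where
  remainder : ∀ {ρ} q → ρ < suc w → (ρ + q * suc w) % suc w ≡ ρ
  remainder {ρ} q ρ< = trans ([m+kn]%n≡m%n ρ q (suc w)) (m<n⇒m%n≡m ρ<)
  ρ≡ρ′ : ρ ≡ ρ′
  ρ≡ρ′ = trans (sym (remainder q ρ<)) (trans (cong (_% suc w) eq) (remainder q′ ρ′<))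

-- With i < 5u, ε + 2i ≤ 2(i + 1) ≤ 10u. This limits the number of fans that fit into the slots to
-- 5u.
offset-bound : ∀ u i {e} → i < 5 * u → e ≤ 2 → e + i * 2 < 2 + 10 * u
offset-bound u i {e} i< e≤ = begin-strict
  e + i * 2          ≤⟨ ℕ.+-monoˡ-≤ (i * 2) e≤ ⟩
  suc i * 2          <⟨ s≤s (ℕ.≤-trans (ℕ.*-monoˡ-≤ 2 i<) (ℕ.n≤1+n _)) ⟩
  2 + 5 * u * 2      ≡⟨ double u ⟩
  2 + 10 * u         ∎
  where
  open ℕ.≤-Reasoning
  double : ∀ u → 2 + 5 * u * 2 ≡ 2 + 10 * u
  double = solve-∀

FanLength : ℕ → ℕ → ℕ → Set
FanLength u i ℓ = ∃ λ E → E ∈ᴸ fan-cycles × ℓ ≡ slot-length u i (slot E) (offset E)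

-- Division by the slot width recovers the slot and ε + 2i. The latter has the parity of ε, which
-- together with the slot determines the cycle; then ε is known, and i follows. The first conclusion
-- separates the cycles of one fan, the second those of different fans.
fan-length-injective : ∀ u i i′ {E F} → i < 5 * u → i′ < 5 * u → E ∈ᴸ fan-cycles → F ∈ᴸ fan-cycles →
  slot-length u i (slot E) (offset E) ≡ slot-length u i′ (slot F) (offset F) → E ≡ F × i ≡ i′
fan-length-injective u i i′ {E} {F} i< i′< p q eq = E≡F ,
  ℕ.*-cancelʳ-≡ i i′ 2 (ℕ.+-cancelˡ-≡ (offset E) _ _
    (trans offsets≡ (cong (λ G → offset G + i′ * 2) (sym E≡F))))
  where
  bound : ∀ i {G} → i < 5 * u → G ∈ᴸ fan-cycles → offset G + i * 2 < 2 + 10 * u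
  bound i i< p = offset-bound u i i< (proj₁ (proj₂ (All.lookup in-slot p)))
  decoded : offset E + i * 2 ≡ offset F + i′ * 2 × slot E ≡ slot F
  -- `divMod-unique` divides by the successor of its first argument, here 10u + 2.
  decoded = divMod-unique (suc (10 * u)) (slot E) (slot F) (bound i i< p) (bound i′ i′< q)
    (ℕ.+-cancelˡ-≡ (42 * u + 39) _ _ (trans (sym (slot-length-shape u i (slot E) (offset E)))
      (trans eq (slot-length-shape u i′ (slot F) (offset F)))))
  offsets≡ = proj₁ decoded
  E≡F : E ≡ F
  E≡F = slot-injective p q (proj₂ decoded)
    (trans (sym ([m+kn]%n≡m%n (offset E) i 2))
      (trans (cong (_% 2) offsets≡) ([m+kn]%n≡m%n (offset F) i′ 2)))

fan-weight : ∀ u i {E} → E ∈ᴸ fan-cycles →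
             weight (map (eval u i) fan-forms) E ≡ slot-length u i (slot E) (offset E)
fan-weight u i {E} p = trans (weight-eval u i fan-forms E)
  (cong (eval u i) (proj₂ (proj₂ (All.lookup in-slot p))))

fan : ∀ u i → i < 5 * u → Bouquet (FanLength u i) (237 * u + 151 + 7 * i) 6
fan u i i< = record
  { es = fan-edges ; xs = map (eval u i) fan-forms ; spectrum = sp
  ; vertices = size u i ; excess = refl }
  where
  -- The sum of the eleven evaluated forms, written out for the ring solver; the final 5 counts the
  -- path vertices present before subdivision.
  size : ∀ u i →
    (26 * u + 1 * i + 20) + ((16 * u + 1 * i + 18) + ((16 * u + 1 * i + 18) + ((26 * u + 1 * i + 20) +
    ((16 * u + 1 * i + 18) + ((31 * u + 1 * i + 21) + ((20 * u + 0 * i + 3) + ((20 * u + 0 * i + 2) +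
    ((30 * u + 0 * i + 6) + ((25 * u + 0 * i + 4) + ((11 * u + 1 * i + 16) + 0)))))))))) + 5 ≡
    237 * u + 151 + 7 * i
  size = solve-∀
  member : ∀ E → RegularOffRoot fan-edges E → deg fan-edges E zero ≡ 2 → E ∈ᴸ fan-cycles
  member E r d = fan-complete E r (ℕ.≤-reflexive d) λ { refl → contradiction d λ () }
  sp : Spectrum fan-edges (map (eval u i) fan-forms) (FanLength u i)
  sp .classify E r d with E ≟ˢ ⊥
  ... | yes E≡⊥ = inj₁ E≡⊥
  ... | no E≢⊥  = let p = fan-complete E r d E≢⊥ in
    inj₂ (proj₁ (All.lookup in-slot p) , E , p , fan-weight u i p)
  sp .unique E F rE rF dE dF eq = proj₁ (fan-length-injective u i i i< i< p q
    (trans (sym (fan-weight u i p)) (trans eq (fan-weight u i q))))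
    where
    p = member E rE dE
    q = member F rF dF

fans-size : ℕ → ℕ → ℕ
fans-size u zero    = 0
fans-size u (suc k) = fans-size u k + (237 * u + 151 + 7 * k)

fans : ∀ u k → k ≤ 5 * u → Bouquet (λ ℓ → ∃ λ i → i < k × FanLength u i ℓ) (fans-size u k) (k * 6)
fans u zero    _  = widenᴮ (λ ()) point
fans u (suc k) k< = subst (Bouquet _ _) (ℕ.+-comm (k * 6) 6)
  (widenᴮ [ (λ (i , i<k , p) → i , ℕ.m≤n⇒m≤1+n i<k , p) , (λ p → k , ℕ.≤-refl , p) ]′
    (fans u k (ℕ.<⇒≤ k<) ∨ fan u k k< [ disjoint ]))
  where
  disjoint : ∀ {ℓ} → ∃ (λ i → i < k × FanLength u i ℓ) → ¬ FanLength u k ℓ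
  disjoint (i , i<k , E , p , eq) (F , q , eq′) = ℕ.<⇒≢ i<k
    (proj₂ (fan-length-injective u i k (ℕ.<-trans i<k k<) k< p q (trans (sym eq) eq′)))

-- Vertex counts in closed form

-- The triangular number k(k - 1)/2, free of division and subtraction.
loops-size-closed : ∀ k → 2 * loops-size k + k ≡ k * k
loops-size-closed zero    = refl
loops-size-closed (suc k) = begin
  2 * (loops-size k + k) + suc k        ≡⟨ rearrange (loops-size k) k ⟩
  (2 * loops-size k + k) + (2 * k + 1)  ≡⟨ cong (_+ (2 * k + 1)) (loops-size-closed k) ⟩
  k * k + (2 * k + 1)                   ≡⟨ square k ⟩
  suc k * suc k                         ∎
  where
  open ≡-Reasoning
  rearrange : ∀ s k → 2 * (s + k) + suc k ≡ (2 * s + k) + (2 * k + 1)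
  rearrange = solve-∀
  square : ∀ k → k * k + (2 * k + 1) ≡ suc k * suc k
  square = solve-∀

-- Twice an arithmetic series; the 7k on the left stands for the subtraction in 7k(k - 1).
fans-size-closed : ∀ u k → 2 * fans-size u k + 7 * k ≡ k * (474 * u + 302 + 7 * k)
fans-size-closed u zero    = refl
fans-size-closed u (suc k) = begin
  2 * (fans-size u k + (237 * u + 151 + 7 * k)) + 7 * suc k
    ≡⟨ rearrange (fans-size u k) u k ⟩
  (2 * fans-size u k + 7 * k) + (474 * u + 302 + 14 * k + 7)
    ≡⟨ cong (_+ (474 * u + 302 + 14 * k + 7)) (fans-size-closed u k) ⟩
  k * (474 * u + 302 + 7 * k) + (474 * u + 302 + 14 * k + 7)
    ≡⟨ expand u k ⟩
  suc k * (474 * u + 302 + 7 * suc k) ∎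
  where
  open ≡-Reasoning
  rearrange : ∀ s u k → 2 * (s + (237 * u + 151 + 7 * k)) + 7 * suc k ≡
                        (2 * s + 7 * k) + (474 * u + 302 + 14 * k + 7)
  rearrange = solve-∀
  expand : ∀ u k → k * (474 * u + 302 + 7 * k) + (474 * u + 302 + 14 * k + 7) ≡
                   suc k * (474 * u + 302 + 7 * suc k)
  expand = solve-∀

-- The final graph and the bound

-- Stopping the single cycles at 42u + 37 makes the excess 72u + 37 = 36t + 1, where the 1 makes up
-- for the root. Fan lengths start at 42u + 39, so the two families are disjoint.
bouquet : ∀ u → Bouquet _ (loops-size (42 * u + 37) + fans-size u (5 * u)) (42 * u + 37 + 5 * u * 6)
bouquet u = loops (42 * u + 37) ∨ fans u (5 * u) ℕ.≤-refl [ disjoint ]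
  where
  disjoint : ∀ {ℓ} → ℓ ≤ 42 * u + 37 → ¬ ∃ λ i → i < 5 * u × FanLength u i ℓ
  disjoint {ℓ} ℓ≤ (i , _ , E , _ , eq) = ℕ.<-irrefl refl (begin-strict
    42 * u + 37                         <⟨ ℕ.+-monoʳ-< (42 * u) (ℕ.n<1+n 37) ⟩
    42 * u + 38                         ≤⟨ ℕ.+-monoʳ-≤ (42 * u) (ℕ.n≤1+n 38) ⟩
    42 * u + 39                         ≤⟨ ℕ.m≤m+n _ _ ⟩
    42 * u + 39 + _                     ≡⟨ slot-length-shape u i (slot E) (offset E) ⟨
    slot-length u i (slot E) (offset E) ≡⟨ eq ⟨
    ℓ                                   ≤⟨ ℓ≤ ⟩
    42 * u + 37                         ∎)
    where open ℕ.≤-Reasoning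

many-edges : ∀ u n → 2 + (loops-size (42 * u + 37) + fans-size u (5 * u)) ≤ n →
             n + 36 * (2 * u + 1) ≤ f n
-- The 2 counts the root and the first vertex of the pendant path, whose other `o` vertices bring
-- the total to n.
many-edges u n le with o , refl ← ℕ.m≤n⇒∃[o]m+o≡n le =
  proj₂ (f-isMaximum _) _ (subst₂ Admissible (vertices s o) (edges s o u)
    (bouquet⇒admissible (bouquet u ∨ pendant-block o [ (λ _ ()) ])))
  where
  s = loops-size (42 * u + 37) + fans-size u (5 * u)
  vertices : ∀ s o → suc (s + suc o) ≡ 2 + s + o
  vertices = solve-∀
  edges : ∀ s o u → s + suc o + (42 * u + 37 + 5 * u * 6 + 0) ≡ 2 + s + o + 36 * (2 * u + 1)
  edges = solve-∀

size-bound : ∀ u → 2 * (2 + (loops-size (42 * u + 37) + fans-size u (5 * u))) ≤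
             2 * (540 * (2 * u + 1) ^ 2) + 175811 * (2 * u + 1) + 7989
-- 77u + 37 is the sum of the terms 42u + 37 and 7 · 5u that the two closed forms carry on their
-- left sides.
size-bound u = ℕ.+-cancelʳ-≤ (77 * u + 37) _ _ (begin
  2 * (2 + (x + y)) + (77 * u + 37)                                 ≡⟨ regroup x y u ⟩
  (2 * x + (42 * u + 37)) + (2 * y + 7 * (5 * u)) + 4               ≡⟨ cong₂ (λ a b → a + b + 4)
                                                                         (loops-size-closed (42 * u + 37))
                                                                         (fans-size-closed u (5 * u)) ⟩
  (42 * u + 37) * (42 * u + 37) + 5 * u * (474 * u + 302 + 7 * (5 * u)) + 4
    -- The slack is the difference of the two polynomials. Its leading coefficient is 11 because 42²
    -- + 5 · (474 + 35) = 4309, against 8 · 540 = 4320.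
    ≤⟨ ℕ.m≤m+n _ (11 * (u * u) + 351401 * u + 183544) ⟩
  (42 * u + 37) * (42 * u + 37) + 5 * u * (474 * u + 302 + 7 * (5 * u)) + 4 +
    (11 * (u * u) + 351401 * u + 183544)
    ≡⟨ compare u ⟩
  2 * (540 * (2 * u + 1) ^ 2) + 175811 * (2 * u + 1) + 7989 + (77 * u + 37) ∎)
  where
  open ℕ.≤-Reasoning
  x = loops-size (42 * u + 37)
  y = fans-size u (5 * u)
  regroup : ∀ x y u → 2 * (2 + (x + y)) + (77 * u + 37) ≡
                      (2 * x + (42 * u + 37)) + (2 * y + 7 * (5 * u)) + 4
  regroup = solve-∀
  compare : ∀ u → (42 * u + 37) * (42 * u + 37) + 5 * u * (474 * u + 302 + 7 * (5 * u)) + 4 +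
                  (11 * (u * u) + 351401 * u + 183544) ≡
                  2 * (540 * ((2 * u + 1) * ((2 * u + 1) * 1))) + 175811 * (2 * u + 1) + 7989 + (77 * u + 37)
  compare = solve-∀

mainTheorem1 : ∀ (r t n : ℕ) → 1 ≤ r → t ≡ 1260 * r + 169 →
    2 * (540 * t ^ 2) + 175811 * t + 7989 ≤ 2 * n →
    n + 36 * t ≤ f n
mainTheorem1 r t n _ t≡ le = subst (λ t → n + 36 * t ≤ f n) (sym t≡2u+1)
  (many-edges u n (ℕ.*-cancelˡ-≤ 2 (ℕ.≤-trans (size-bound u)
    (subst (λ t → 2 * (540 * t ^ 2) + 175811 * t + 7989 ≤ 2 * n) t≡2u+1 le))))
  where
  -- As t is odd, u = (t - 1)/2.
  u = 630 * r + 84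
  odd : ∀ r → 1260 * r + 169 ≡ 2 * (630 * r + 84) + 1
  odd = solve-∀
  t≡2u+1 : t ≡ 2 * u + 1
  t≡2u+1 = trans t≡ (odd r)
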